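{- Let $\mathfrak F=(X,\parallel,Y)$ be a polarity and $\mathcal G(X)$ its complete lattice of stable sets. Let $R_\leq\subseteq X\times X\times X$ be the upper bound relation, $u R_\leq x z$ iff $x\preceq u$ and $z\preceq u$, and let $R'_\leq\subseteq Y\times X\times X$ be its Galois dual relation: $y R'_\leq xz$ iff for all $u\in X$, $uR_\leq xz$ implies $u\parallel y$. Suppose all sections of $R'_\leq$ are Galois sets, i.e. for all $x,z\in X$ the set $\{y\in Y: yR'_\leq xz\}$ is co-stable, and for all $y\in Y$ and $x,z\in X$ the sets $\{x\in X: yR'_\leq xz\}$ and $\{z\in X: yR'_\leq xz\}$ are stable. Then $\mathcal G(X)$ is completely distributive (in particular $A\cap\bigvee_{j\in J}C_j=\bigvee_{j\in J}(A\cap C_j)$ for stable $A,C_j$).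
   Context: A polarity is a triple $\mathfrak F=(X,\parallel,Y)$ with $X,Y$ nonempty sets and ${\parallel}\subseteq X\times Y$. For $U\subseteq X$ put $U'=\{y\in Y:\forall x\in U\; x\parallel y\}$ and for $V\subseteq Y$ put $V'=\{x\in X:\forall y\in V\; x\parallel y\}$. A set $A\subseteq X$ is stable if $A=A''$, a set $B\subseteq Y$ is co-stable if $B=B''$; both are called Galois sets. $\mathcal G(X)$ (resp. $\mathcal G(Y)$) is the complete lattice of stable (resp. co-stable) sets ordered by inclusion, with meets given by intersection and joins $\bigvee_j A_j=(\bigcup_j A_j)''$. The preorder $\preceq$ on $X$ is $x\preceq z$ iff $\{x\}'\subseteq\{z\}'$.
   Formalization: "Completely distributive" is taken to mean the displayed law, that meets distribute over arbitrary joins; the stronger choice-function law fails under these hypotheses, e.g. for the polarity (L,≤,L) with L an atomless complete Boolean algebra. -}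

module Defs where

open import Level using (Level; _⊔_; suc)
open import Data.Product using (_×_; _,_; proj₁; proj₂)
open import Relation.Binary using (Rel; REL; Poset)
open import Relation.Binary.Lattice.Definitions using (Infimum)
open import Relation.Unary
  using (Pred; _∈_; _⊆_; _≐_; _∩_; ⋃; ⋂; ｛_｝)
open import Relation.Unary.Properties using (≐-refl; ≐-sym; ≐-trans)

module _ {c ℓ₁ ℓ₂ ι : Level} (P : Poset c ℓ₁ ℓ₂) where
  open Poset P renaming (Carrier to L)

  IsSup : {J : Set ι} → (J → L) → L → Set _
  IsSup f s = (∀ j → f j ≤ s) × (∀ u → (∀ j → f j ≤ u) → s ≤ u)

  IsInf : {J : Set ι} → (J → L) → L → Set _
  IsInf f i = (∀ j → i ≤ f j) × (∀ u → (∀ j → u ≤ f j) → u ≤ i)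

-- The binary meet is a field of its own (determined up to ≈ by ∧-inf) so
-- that in the lattice of stable sets it is literally intersection.
-- Completeness is relative to families indexed by sets in the universe ι.
record CompleteLattice (c ℓ₁ ℓ₂ ι : Level) : Set (suc (c ⊔ ℓ₁ ⊔ ℓ₂ ⊔ ι)) where
  field
    poset : Poset c ℓ₁ ℓ₂
  open Poset poset public
  field
    _∧_   : Carrier → Carrier → Carrier
    ⋀     : (J : Set ι) → (J → Carrier) → Carrier
    ⋁     : (J : Set ι) → (J → Carrier) → Carrier
    ∧-inf : Infimum _≤_ _∧_
    ⋀-inf : ∀ {J} (f : J → Carrier) → IsInf poset f (⋀ J f)
    ⋁-sup : ∀ {J} (f : J → Carrier) → IsSup poset f (⋁ J f)

-- "Completely distributive" in the sense common in the semantics of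
-- non-classical logics: meets distribute over arbitrary joins.  This is the
-- frame law, not the choice-function law ⋀ᵢ⋁ⱼ aᵢⱼ = ⋁_f ⋀ᵢ aᵢ₍f i₎, which is
-- stronger: for an atomless complete Boolean algebra L the polarity (L,≤,L)
-- has all sections of R′≤ Galois and stable-set lattice isomorphic to L,
-- which satisfies the former law but not the latter.
CompletelyDistributive : ∀ {c ℓ₁ ℓ₂ ι} → CompleteLattice c ℓ₁ ℓ₂ ι → Set _
CompletelyDistributive {ι = ι} 𝓛 =
  ∀ (J : Set ι) (a : Carrier) (c : J → Carrier) →
  (a ∧ ⋁ J c) ≈ ⋁ J (λ j → a ∧ c j)
  where open CompleteLattice 𝓛

record Polarity (a b r : Level) : Set (suc (a ⊔ b ⊔ r)) where
  infix 4 _∥_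
  field
    X   : Set a
    Y   : Set b
    _∥_ : REL X Y r
    -- X and Y are nonempty
    x₀  : X
    y₀  : Y

module Galois {a b r : Level} (𝔉 : Polarity a b r) where
  open Polarity 𝔉

  infix 12 _′ˣ _′ʸ

  _′ˣ : ∀ {p} → Pred X p → Pred Y (a ⊔ p ⊔ r)
  (U ′ˣ) y = ∀ x → x ∈ U → x ∥ y

  _′ʸ : ∀ {p} → Pred Y p → Pred X (b ⊔ p ⊔ r)
  (V ′ʸ) x = ∀ y → y ∈ V → x ∥ y

  Stable : ∀ {p} → Pred X p → Set _
  Stable A = A ≐ (A ′ˣ) ′ʸ

  CoStable : ∀ {p} → Pred Y p → Set _
  CoStable B = B ≐ (B ′ʸ) ′ˣ

  infix 4 _⪯_

  _⪯_ : Rel X _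
  x ⪯ z = ｛ x ｝ ′ˣ ⊆ ｛ z ｝ ′ˣ

  -- R≤ u x z is  u R≤ xz,  and  R′≤ y x z  is  y R′≤ xz.
  R≤ : X → X → X → Set _
  R≤ u x z = x ⪯ u × z ⪯ u

  R′≤ : Y → X → X → Set _
  R′≤ y x z = ∀ u → R≤ u x z → u ∥ y

  record AllSectionsGalois : Set (a ⊔ b ⊔ r) where
    field
      Y-section  : ∀ x z → CoStable (λ y → R′≤ y x z)
      X₁-section : ∀ y z → Stable (λ x → R′≤ y x z)
      X₂-section : ∀ y x → Stable (λ z → R′≤ y x z)

  -- The level of subsets of X; it is closed under (_)″ and under unions
  -- and intersections of families indexed by sets in the same universe.
  s : Level
  s = a ⊔ b ⊔ r

  record StableSet : Set (suc s) where
    constructor _,_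
    field
      set    : Pred X s
      stable : Stable set
  open StableSet public

  ⊆″ : ∀ {p} (U : Pred X p) → U ⊆ (U ′ˣ) ′ʸ
  ⊆″ U {x} x∈U y y∈U′ = y∈U′ x x∈U

  ″-least : ∀ {p q} (U : Pred X p) {A : Pred X q} →
            Stable A → U ⊆ A → (U ′ˣ) ′ʸ ⊆ A
  ″-least U (_ , A″⊆A) U⊆A x∈U″ =
    A″⊆A (λ y y∈A′ → x∈U″ y (λ x x∈U → y∈A′ x (U⊆A x∈U)))

  ″-stable : ∀ {p} (U : Pred X p) → Stable ((U ′ˣ) ′ʸ)
  ″-stable U = ⊆″ ((U ′ˣ) ′ʸ) , λ x∈U⁗ y y∈U′ → x∈U⁗ y (λ x x∈U″ → x∈U″ y y∈U′)

  𝒢-poset : Poset (suc s) s s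
  𝒢-poset = record
    { Carrier = StableSet
    ; _≈_ = λ A B → set A ≐ set B
    ; _≤_ = λ A B → set A ⊆ set B
    ; isPartialOrder = record
      { isPreorder = record
        { isEquivalence = record
          { refl = ≐-refl ; sym = ≐-sym ; trans = ≐-trans }
        ; reflexive = proj₁
        ; trans = λ A⊆B B⊆C x∈A → B⊆C (A⊆B x∈A)
        }
      ; antisym = _,_
      }
    }

  _∩ˢ_ : StableSet → StableSet → StableSet
  A ∩ˢ B = (set A ∩ set B) ,
    ( ⊆″ (set A ∩ set B)
    , λ x∈ → ″-least (set A ∩ set B) (stable A) proj₁ x∈
           , ″-least (set A ∩ set B) (stable B) proj₂ x∈ )

  ⋂ˢ : (J : Set s) → (J → StableSet) → StableSet
  ⋂ˢ J A = I ,
    (⊆″ I , λ x∈ j → ″-least I (stable (A j)) (λ x∈I → x∈I j) x∈)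
    where
    I : Pred X s
    I = ⋂ J (λ j → set (A j))

  ⋁ˢ : (J : Set s) → (J → StableSet) → StableSet
  ⋁ˢ J A = (U ′ˣ) ′ʸ , ″-stable U
    where
    U : Pred X s
    U = ⋃ J (λ j → set (A j))

  𝒢 : CompleteLattice (suc s) s s s
  𝒢 = record
    { poset = 𝒢-poset
    ; _∧_   = _∩ˢ_
    ; ⋀     = ⋂ˢ
    ; ⋁     = ⋁ˢ
    ; ∧-inf = λ A B → proj₁ , proj₂ , λ C C⊆A C⊆B x∈C → C⊆A x∈C , C⊆B x∈C
    ; ⋀-inf = λ A → (λ j x∈ → x∈ j) , λ B B⊆A x∈B j → B⊆A j x∈B
    ; ⋁-sup = λ {J} A →
          (λ j x∈A → ⊆″ (⋃ J (λ j → set (A j))) (j , x∈A))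
        , λ B A⊆B → ″-least (⋃ J (λ j → set (A j))) (stable B)
                      (λ { (j , x∈A) → A⊆B j x∈A })
    }

{-# OPTIONS --safe #-}
-- Let x ∈ A ∩ ⋁ⱼ Cⱼ and y ∈ (⋃ⱼ (A ∩ Cⱼ))′.  Stable sets are upward closed for
-- ⪯, so every upper bound of x and some z ∈ Cⱼ lies in A ∩ Cⱼ and hence is
-- related to y; thus ⋃ⱼ Cⱼ is contained in the section {z : y R′≤ xz}.  This
-- section being stable, it contains x, and y R′≤ xx gives x ∥ y.
module Submission where

open import Data.Product using (_,_)
open import Function using (id)
open import Relation.Binary.PropositionalEquality using (refl)
open import Relation.Unary using (Pred; _∈_; _⊆_; ⋃)

open import Defs

module _ {a b r} (𝔉 : Polarity a b r) where
  open Polarity 𝔉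
  open Galois 𝔉

  -- Each `y` in `A ′ˣ` is related to `x`, so it lies in `｛ x ｝ ′ˣ` and hence, by `x ⪯ z`, in
  -- `｛ z ｝ ′ˣ`; thus `z` is in the closure of `A`.
  stable-upward : ∀ {p} {A : Pred X p} → Stable A →
                  ∀ {x z} → x ∈ A → x ⪯ z → z ∈ A
  stable-upward (_ , A″⊆A) x∈A x⪯z =
    A″⊆A λ y y∈A′ → x⪯z (λ { x refl → y∈A′ x x∈A }) _ refl

  -- By reflexivity of `⪯`, `x` is itself an upper bound of `x` and `x`.
  R′≤-diagonal : ∀ {x y} → R′≤ y x x → x ∥ y
  R′≤-diagonal yR′xx = yR′xx _ (id , id)

  ∩ˢ-distribˡ-⋁ˢ-⊆ : (∀ y x → Stable (R′≤ y x)) →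
                     ∀ J A (C : J → StableSet) →
                     set (A ∩ˢ ⋁ˢ J C) ⊆ set (⋁ˢ J λ j → A ∩ˢ C j)
  ∩ˢ-distribˡ-⋁ˢ-⊆ section-stable J A C {x} (x∈A , x∈⋁C) y y∈⋃[A∩C]′ =
    R′≤-diagonal
      (″-least (⋃ J λ j → set (C j)) (section-stable y x) ⋃C⊆section x∈⋁C)
    where
    ⋃C⊆section : ⋃ J (λ j → set (C j)) ⊆ R′≤ y x
    ⋃C⊆section (j , z∈Cj) u (x⪯u , z⪯u) =
      y∈⋃[A∩C]′ u ( j , stable-upward (stable A) x∈A x⪯u
                      , stable-upward (stable (C j)) z∈Cj z⪯u )

  -- This half holds in every complete lattice: here the right-hand side is stable and contains each
  -- `A ∩ˢ C j`.
  ⋁ˢ-∩ˢ-⊆ : ∀ J A (C : J → StableSet) →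
            set (⋁ˢ J λ j → A ∩ˢ C j) ⊆ set (A ∩ˢ ⋁ˢ J C)
  ⋁ˢ-∩ˢ-⊆ J A C =
    ″-least (⋃ J λ j → set (A ∩ˢ C j)) (stable (A ∩ˢ ⋁ˢ J C))
      λ { (j , x∈A , x∈Cj) → x∈A , ⊆″ (⋃ J λ j → set (C j)) (j , x∈Cj) }

theorem3p5 : ∀ {a b r} (𝔉 : Polarity a b r) →
    Galois.AllSectionsGalois 𝔉 →
    CompletelyDistributive (Galois.𝒢 𝔉)
theorem3p5 𝔉 sections J A C =
  ∩ˢ-distribˡ-⋁ˢ-⊆ 𝔉 X₂-section J A C , ⋁ˢ-∩ˢ-⊆ 𝔉 J A C
  where open Galois.AllSectionsGalois sections
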